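{- Let $\lambda=(a,\rho,1^t)$ be a partition, where $t\ge0$, $\rho$ is a nonempty partition all of whose parts are at least $2$, and $a\ge\rho_1$. Then $\lambda$ lies in the node-moving closure of the set of long-first-row partitions if and only if $$a+t\ge|\rho|+C(\rho)-1 .$$
   Context: For a nonempty partition $\rho$, $C(\rho)=\max\{\rho_i-i:\rho_i>\rho_{i+1}\}$ (with $\rho_{\ell+1}=0$ past the last part), i.e. the largest content (column minus row) of a removable box. A long-first-row partition is one of the form $(m,\sigma)=(m,\sigma_1,\sigma_2,\dots)$ with $\sigma$ a nonempty partition, $m\ge\sigma_1$ and $m\ge|\sigma|+C(\sigma)-1$. A node move on a partition removes an outer (removable) box from a row of length greater than one and appends a new row of length one, so the total size is preserved and the result is again a partition. The node-moving closure of a set of partitions is the set of all partitions obtained from its members by finite (possibly empty) sequences of node moves. $(a,\rho,1^t)$ denotes the partition with parts $a$, the parts of $\rho$, and $t$ ones. -}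

module Defs where

open import Data.Fin.Base using (Fin; zero; suc; toℕ; fromℕ)
open import Data.Integer.Base as ℤ using (ℤ; +_; 0ℤ; 1ℤ; _⊖_)
open import Data.Integer.Properties using (≤-totalOrder)
open import Data.List.Base
  using (List; []; _∷_; _∷ʳ_; _++_; _[_]%=_; allFin; filter; length; lookup; map; replicate)
open import Data.List.Extrema ≤-totalOrder using (max; argmax-all; xs≤max)
open import Data.List.Membership.Propositional.Properties using (∈-allFin; ∈-filter⁺)
open import Data.List.Relation.Unary.All as All using (All; _∷_)
open import Data.List.Relation.Unary.All.Properties using (map⁺; map⁻; all-filter)
open import Data.List.Relation.Unary.Linked using (Linked)
open import Data.Nat.Base using (ℕ; zero; suc; pred; _<_; _≥_)
open import Data.Nat.ListAction using (sum)
open import Data.Nat.Properties using (_<?_)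
open import Data.Product.Base using (∃-syntax; _×_; _,_)
open import Function.Base using (id)
open import Relation.Binary.Construct.Closure.ReflexiveTransitive using (Star)
open import Relation.Binary.PropositionalEquality using (_≡_; _≢_; refl)
open import Relation.Nullary.Decidable using (Dec)
open import Relation.Nullary.Negation using (contradiction)

record IsPartition (ρ : List ℕ) : Set where
  field
    positive   : All (0 <_) ρ
    decreasing : Linked _≥_ ρ

∣_∣ : List ℕ → ℕ
∣ ρ ∣ = sum ρ

-- Rows are indexed from 0, so that  part ρ i  is ρ_{i+1};
-- it is 0 past the last row.
part : List ℕ → ℕ → ℕ
part []      _       = 0
part (x ∷ _) zero    = x
part (_ ∷ ρ) (suc i) = part ρ i

Removable : (ρ : List ℕ) → Fin (length ρ) → Set
Removable ρ i = part ρ (suc (toℕ i)) < lookup ρ i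

removable? : ∀ ρ (i : Fin (length ρ)) → Dec (Removable ρ i)
removable? ρ i = part ρ (suc (toℕ i)) <? lookup ρ i

content : (ρ : List ℕ) → Fin (length ρ) → ℤ
content ρ i = lookup ρ i ⊖ suc (toℕ i)

removableContents : List ℕ → List ℤ
removableContents ρ = map (content ρ) (filter (removable? ρ) (allFin (length ρ)))

-- The seed required by  max  is the content of the end of the last row.  In a
-- partition that box is removable, so the seed does not affect the maximum
-- (see C-attained and C-upper).  The value at [] is junk.
C : List ℕ → ℤ
C []       = 0ℤ
C (x ∷ xs) = max (content (x ∷ xs) (fromℕ (length xs))) (removableContents (x ∷ xs))

LongFirstRow : List ℕ → Set
LongFirstRow μ = ∃[ m ] ∃[ σ ]
    μ ≡ m ∷ σ
  × IsPartition σ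
  × σ ≢ []
  × m ≥ part σ 0
  × + m ℤ.≥ + ∣ σ ∣ ℤ.+ C σ ℤ.- 1ℤ

NodeMove : List ℕ → List ℕ → Set
NodeMove μ ν = ∃[ i ]
    Removable μ i
  × 1 < lookup μ i
  × ν ≡ (μ [ i ]%= pred) ∷ʳ 1

NodeMovingClosure : (List ℕ → Set) → List ℕ → Set
NodeMovingClosure S ν = ∃[ μ ] S μ × Star NodeMove μ ν

⟨_,_,1^_⟩ : ℕ → List ℕ → ℕ → List ℕ
⟨ a , ρ ,1^ t ⟩ = a ∷ ρ ++ replicate t 1

last-removable : ∀ x xs → All (0 <_) (x ∷ xs) → Removable (x ∷ xs) (fromℕ (length xs))
last-removable x []       (p ∷ _)  = p
last-removable x (y ∷ ys) (_ ∷ ps) = last-removable y ys ps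

C-attained : ∀ {ρ} → IsPartition ρ → ρ ≢ [] → ∃[ i ] Removable ρ i × C ρ ≡ content ρ i
C-attained {[]}     _ ρ≢[] = contradiction refl ρ≢[]
C-attained {x ∷ xs} p _    =
  argmax-all id {P = λ c → ∃[ i ] Removable (x ∷ xs) i × c ≡ content (x ∷ xs) i}
    (_ , last-removable x xs (IsPartition.positive p) , refl)
    (map⁺ (All.map (λ r → _ , r , refl)
      (all-filter (removable? (x ∷ xs)) (allFin (length (x ∷ xs))))))

C-upper : ∀ ρ i → Removable ρ i → content ρ i ℤ.≤ C ρ
C-upper ρ@(_ ∷ _) i r =
  All.lookup (map⁻ (xs≤max _ (removableContents ρ)))
    (∈-filter⁺ (removable? ρ) (∈-allFin i) r)

{-# OPTIONS --safe #-}

-- Only the boxes of (a, σ) below the first row matter.  Write σ = (ρ, 1^t) and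
-- call a corner of σ tall if its row has length at least two; these are exactly
-- the corners of ρ, so the inequality says that every tall corner, with row
-- index k counted from 0, satisfies
--     |σ| + σ_k ≤ a + 2 + k + 2 t.
-- In this form it is preserved by node moves: a move in the first row changes
-- both sides by the same amount, and a move below it raises contents of tall
-- corners by at most one while creating at least one new row of length one.
-- Conversely (a, ρ, 1^t) is reached from the long-first-row partition
-- (a + t, ρ) by shortening the first row t times.
module Submission where

open import Defs
open import Data.Fin.Base using (Fin; zero; suc; toℕ; fromℕ<)
open import Data.Fin.Properties using (toℕ-fromℕ<)
open import Data.Integer.Base as ℤ using (+_; 1ℤ; _⊖_)
import Data.Integer.Properties as ℤ
open import Data.List.Base
  using (List; []; _∷_; _∷ʳ_; _++_; _[_]%=_; filter; length; lookup; replicate)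
open import Data.List.Membership.Propositional.Properties using (∈-lookup)
open import Data.List.Properties using (++-assoc; ++-identityʳ; filter-++; filter-none; length-++)
open import Data.List.Relation.Unary.All as All using (All; _∷_)
open import Data.Nat.Base
  using (ℕ; zero; suc; pred; _+_; _*_; _≤_; _<_; _≥_; z≤n; s≤s; s≤s⁻¹; z<s; s<s)
open import Data.Nat.ListAction using (sum)
open import Data.Nat.ListAction.Properties using (sum-++)
open import Data.Nat.Properties
open import Data.Nat.Tactic.RingSolver using (solve-∀)
open import Data.Product.Base using (∃-syntax; _×_; _,_)
open import Data.Sum.Base using (inj₁; inj₂)
open import Data.Unit.Base using (⊤)
open import Function.Bundles using (_⇔_; mk⇔; module Equivalence)
open import Relation.Binary.Construct.Closure.ReflexiveTransitive using (Star; ε; _◅_)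
open import Relation.Binary.PropositionalEquality
  using (_≡_; _≢_; refl; sym; trans; cong; cong₂; subst; subst₂)
open import Relation.Nullary.Negation using (contradiction)

open Equivalence using (to; from)

TallCorner : List ℕ → ℕ → Set
TallCorner σ k = part σ (suc k) < part σ k × 2 ≤ part σ k

ones : List ℕ → ℕ
ones σ = length (filter (_≟ 1) σ)

-- One copy of `ones σ` cancels the ones counted in `∣ σ ∣`; the other is the summand `t` of
-- `a + t`.
Bounded : List ℕ → Set
Bounded []      = ⊤
Bounded (a ∷ σ) = ∀ k → TallCorner σ k →
  ∣ σ ∣ + part σ k ≤ a + 2 + k + 2 * ones σ

lookup≡part : ∀ σ (i : Fin (length σ)) → lookup σ i ≡ part σ (toℕ i)
lookup≡part (x ∷ σ) zero    = refl
lookup≡part (x ∷ σ) (suc i) = lookup≡part σ i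

part>0⇒<length : ∀ σ k → 0 < part σ k → k < length σ
part>0⇒<length (x ∷ σ) zero    p = z<s
part>0⇒<length (x ∷ σ) (suc k) p = s<s (part>0⇒<length σ k p)

sum-∷ʳ-1 : ∀ σ → ∣ σ ∷ʳ 1 ∣ ≡ suc ∣ σ ∣
sum-∷ʳ-1 σ = trans (sum-++ σ (1 ∷ [])) (+-comm ∣ σ ∣ 1)

ones-∷ʳ-1 : ∀ σ → ones (σ ∷ʳ 1) ≡ suc (ones σ)
ones-∷ʳ-1 σ = trans (cong length (filter-++ (_≟ 1) σ (1 ∷ [])))
  (trans (length-++ (filter (_≟ 1) σ)) (+-comm (ones σ) 1))

part-∷ʳ-1 : ∀ σ k → 2 ≤ part (σ ∷ʳ 1) k → part (σ ∷ʳ 1) k ≡ part σ k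
part-∷ʳ-1 []      zero    (s≤s ())
part-∷ʳ-1 []      (suc k) ()
part-∷ʳ-1 (x ∷ σ) zero    p = refl
part-∷ʳ-1 (x ∷ σ) (suc k) p = part-∷ʳ-1 σ k p

part≤part-∷ʳ : ∀ σ x k → part σ k ≤ part (σ ∷ʳ x) k
part≤part-∷ʳ []      x k       = z≤n
part≤part-∷ʳ (y ∷ σ) x zero    = ≤-refl
part≤part-∷ʳ (y ∷ σ) x (suc k) = part≤part-∷ʳ σ x k

tallCorner-∷ʳ-1⁻ : ∀ σ k → TallCorner (σ ∷ʳ 1) k → TallCorner σ k
tallCorner-∷ʳ-1⁻ σ k (c , 2≤) =
  subst (λ p → part σ (suc k) < p × 2 ≤ p) (part-∷ʳ-1 σ k 2≤)
    (≤-<-trans (part≤part-∷ʳ σ 1 (suc k)) c , 2≤)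

tallCorner-∷ʳ-1⁺ : ∀ σ k → TallCorner σ k → TallCorner (σ ∷ʳ 1) k
-- The row below grows from 0 to 1, so the corner survives because its own row has length at least
-- two.
tallCorner-∷ʳ-1⁺ (x ∷ [])    zero    (_ , 2≤) = 2≤ , 2≤
tallCorner-∷ʳ-1⁺ (x ∷ y ∷ σ) zero    c        = c
tallCorner-∷ʳ-1⁺ (x ∷ σ)     (suc k) c        = tallCorner-∷ʳ-1⁺ σ k c

module _ (a : ℕ) (σ : List ℕ) (k : ℕ) where

  private
    rearrange : ∀ a k o → a + 2 + k + 2 * suc o ≡ suc (suc a + 2 + k + 2 * o)
    rearrange = solve-∀

    rhs : a + 2 + k + 2 * ones (σ ∷ʳ 1) ≡ suc (suc a + 2 + k + 2 * ones σ)
    rhs rewrite ones-∷ʳ-1 σ = rearrange a k (ones σ)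

    lhs : 2 ≤ part (σ ∷ʳ 1) k → ∣ σ ∷ʳ 1 ∣ + part (σ ∷ʳ 1) k ≡ suc (∣ σ ∣ + part σ k)
    lhs 2≤ = cong₂ _+_ (sum-∷ʳ-1 σ) (part-∷ʳ-1 σ k 2≤)

  -- The new row adds 1 on the left; on the right it adds 2 through `ones`, and the shorter first
  -- row takes 1 back.
  bound-∷ʳ-1 : 2 ≤ part (σ ∷ʳ 1) k →
    ∣ σ ∷ʳ 1 ∣ + part (σ ∷ʳ 1) k ≤ a + 2 + k + 2 * ones (σ ∷ʳ 1)
    ⇔ ∣ σ ∣ + part σ k ≤ suc a + 2 + k + 2 * ones σ
  bound-∷ʳ-1 2≤ = mk⇔
    (λ p → s≤s⁻¹ (subst₂ _≤_ (lhs 2≤) rhs p))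
    (λ p → subst₂ _≤_ (sym (lhs 2≤)) (sym rhs) (s≤s p))

bounded-∷ʳ-1 : ∀ a σ → Bounded (a ∷ σ ∷ʳ 1) ⇔ Bounded (suc a ∷ σ)
bounded-∷ʳ-1 a σ = mk⇔
  (λ b k c → let c′@(_ , 2≤) = tallCorner-∷ʳ-1⁺ σ k c in to (bound-∷ʳ-1 a σ k 2≤) (b k c′))
  (λ b k c@(_ , 2≤) → from (bound-∷ʳ-1 a σ k 2≤) (b k (tallCorner-∷ʳ-1⁻ σ k c)))

bounded-++-1^ : ∀ a σ t → Bounded (a ∷ σ ++ replicate t 1) → Bounded (a + t ∷ σ)
bounded-++-1^ a σ zero    b rewrite ++-identityʳ σ | +-identityʳ a = b
bounded-++-1^ a σ (suc t) b
  rewrite sym (++-assoc σ (1 ∷ []) (replicate t 1)) | +-suc a t =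
  to (bounded-∷ʳ-1 (a + t) σ) (bounded-++-1^ a (σ ∷ʳ 1) t b)

sum-pred : ∀ σ i → 0 < lookup σ i → suc ∣ σ [ i ]%= pred ∣ ≡ ∣ σ ∣
sum-pred (suc x ∷ σ) zero    p = refl
sum-pred (x ∷ σ)     (suc i) p =
  trans (sym (+-suc x _)) (cong (λ s → x + s) (sum-pred σ i p))

-- The shortened row was not a one, so no one is lost; a row of length two becomes a new one.
ones-pred : ∀ σ i → 1 < lookup σ i → ones σ ≤ ones (σ [ i ]%= pred)
ones-pred (1 ∷ σ)                 zero    (s≤s ())
ones-pred (suc (suc zero) ∷ σ)    zero    p = n≤1+n _
ones-pred (suc (suc (suc x)) ∷ σ) zero    p = ≤-refl
ones-pred (0 ∷ σ)                 (suc i) p = ones-pred σ i p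
ones-pred (1 ∷ σ)                 (suc i) p = s≤s (ones-pred σ i p)
ones-pred (suc (suc x) ∷ σ)       (suc i) p = ones-pred σ i p

-- The only tall corner that can be new outside row i is the box directly above
-- the removed one, whose content is one larger; then l = k + 1.
tallCorner-pred : ∀ σ i k → Removable σ i → TallCorner (σ [ i ]%= pred) k →
  ∃[ l ] TallCorner σ l × part (σ [ i ]%= pred) k + l ≤ suc (part σ l + k)
tallCorner-pred (suc x ∷ σ) zero zero r (c , 2≤) =
  0 , (r , m≤n⇒m≤1+n 2≤) , +-monoˡ-≤ 0 (m≤n⇒m≤1+n (n≤1+n x))
tallCorner-pred (x ∷ σ) zero (suc k) r c = suc k , c , n≤1+n _
tallCorner-pred (x ∷ y ∷ σ) (suc zero) zero r (c , 2≤)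
  -- Here `c` says `pred y < x`, hence `y ≤ x`: the corner in row 0 is old if `y < x` and newly
  -- exposed if `y ≡ x`.
  with m≤n⇒m<n∨m≡n (≤-trans (suc-pred-≤ y) c)
  where
  suc-pred-≤ : ∀ n → n ≤ suc (pred n)
  suc-pred-≤ zero    = z≤n
  suc-pred-≤ (suc n) = ≤-refl
... | inj₁ y<x  = 0 , (y<x , 2≤) , n≤1+n _
... | inj₂ refl = 1 , (r , 2≤) , ≤-reflexive (trans (+-comm y 1) (cong suc (sym (+-identityʳ y))))
tallCorner-pred (x ∷ y ∷ σ) (suc (suc i)) zero r c = 0 , c , n≤1+n _
tallCorner-pred (x ∷ σ) (suc i) (suc k) r c
  with l , c′ , p ← tallCorner-pred σ i k r c =
  suc l , c′ , subst₂ _≤_ (sym (+-suc _ l)) (cong suc (sym (+-suc _ k))) (s≤s p)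

-- This is half of a move below the first row: the removed box is credited to the first row, and
-- `bounded-∷ʳ-1` then trades that credit for the new row of length one.
bounded-pred : ∀ a σ i → Removable σ i → 1 < lookup σ i →
  Bounded (a ∷ σ) → Bounded (suc a ∷ (σ [ i ]%= pred))
bounded-pred a σ i r 1< b k c with l , c′ , p ← tallCorner-pred σ i k r c =
  -- Adding `suc l` lets contents in rows `k` and `l` be compared without subtraction. A content
  -- rise of one is paid for by the box missing from `sum τ`.
  +-cancelʳ-≤ (suc l) _ _ (begin
    sum τ + part τ k + suc l                  ≡⟨ regroup₁ (sum τ) (part τ k) l ⟩
    suc (sum τ) + (part τ k + l)                ≤⟨ +-monoʳ-≤ (suc (sum τ)) p ⟩
    suc (sum τ) + suc (part σ l + k)            ≡⟨ cong (_+ suc (part σ l + k)) (sum-pred σ i (<⇒≤ 1<)) ⟩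
    sum σ + suc (part σ l + k)                ≡⟨ regroup₂ (sum σ) (part σ l) k ⟩
    sum σ + part σ l + suc k                  ≤⟨ +-monoˡ-≤ (suc k) (b l c′) ⟩
    a + 2 + l + 2 * ones σ + suc k            ≤⟨ +-monoˡ-≤ (suc k) ones≤ ⟩
    a + 2 + l + 2 * ones τ + suc k            ≤⟨ n≤1+n _ ⟩
    suc (a + 2 + l + 2 * ones τ + suc k)      ≡⟨ regroup₃ a k l (ones τ) ⟩
    suc a + 2 + k + 2 * ones τ + suc l        ∎)
  where
  open ≤-Reasoning

  τ = σ [ i ]%= pred

  ones≤ : a + 2 + l + 2 * ones σ ≤ a + 2 + l + 2 * ones τ
  ones≤ = +-monoʳ-≤ (a + 2 + l) (*-monoʳ-≤ 2 (ones-pred σ i 1<))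

  regroup₁ : ∀ s p l → s + p + suc l ≡ suc s + (p + l)
  regroup₁ = solve-∀

  regroup₂ : ∀ s p k → s + suc (p + k) ≡ s + p + suc k
  regroup₂ = solve-∀

  regroup₃ : ∀ a k l o →
    suc (a + 2 + l + 2 * o + suc k) ≡ suc a + 2 + k + 2 * o + suc l
  regroup₃ = solve-∀

bounded-nodeMove : ∀ {μ ν} → NodeMove μ ν → Bounded μ → Bounded ν
bounded-nodeMove {suc a ∷ σ} (zero , _ , _ , refl)   b = from (bounded-∷ʳ-1 a σ) b
bounded-nodeMove {a ∷ σ}     (suc i , r , 1< , refl) b =
  from (bounded-∷ʳ-1 a (σ [ i ]%= pred)) (bounded-pred a σ i r 1< b)

bounded-nodeMoves : ∀ {μ ν} → Star NodeMove μ ν → Bounded μ → Bounded ν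
bounded-nodeMoves ε        b = b
bounded-nodeMoves (m ◅ ms) b = bounded-nodeMoves ms (bounded-nodeMove m b)

-- The 2 collects the final `1ℤ` and the shift from `k` to `suc k` in the content.
content-bound : ∀ m s p k →
  + s ℤ.+ (p ⊖ suc k) ℤ.- 1ℤ ℤ.≤ + m ⇔ s + p ≤ m + 2 + k
content-bound m s p k = mk⇔
  (λ q → ℤ.drop‿+≤+ (subst₂ ℤ._≤_ lhs rhs (ℤ.+-monoˡ-≤ (+ (2 + k)) q)))
  (λ q → ℤ.≮⇒≥ λ m< → ℤ.<⇒≱
    (subst₂ ℤ._<_ rhs lhs (ℤ.+-monoˡ-< (+ (2 + k)) m<)) (ℤ.+≤+ q))
  where
  rhs : + m ℤ.+ + (2 + k) ≡ + (m + 2 + k)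
  rhs = cong +_ (sym (+-assoc m 2 k))

  lhs : + s ℤ.+ (p ⊖ suc k) ℤ.- 1ℤ ℤ.+ + (2 + k) ≡ + (s + p)
  lhs = trans (ℤ.+-assoc (+ s ℤ.+ (p ⊖ suc k)) (ℤ.- 1ℤ) (+ (2 + k)))
    (trans (ℤ.+-assoc (+ s) (p ⊖ suc k) (+ suc k))
      (cong (λ z → + s ℤ.+ z)
        (trans (cong (ℤ._+ + suc k) (sym (ℤ.m-n≡m⊖n p (suc k))))
          (trans (ℤ.+-assoc (+ p) (ℤ.- + suc k) (+ suc k))
            (trans (cong (λ z → + p ℤ.+ z) (ℤ.+-inverseˡ (+ suc k)))
              (ℤ.+-identityʳ (+ p)))))))

longFirstRow⇒bounded : ∀ {μ} → LongFirstRow μ → Bounded μ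
longFirstRow⇒bounded (m , σ , refl , _ , _ , _ , long) k (c , 2≤) =
  ≤-trans (to (content-bound m ∣ σ ∣ (part σ k) k)
    (ℤ.≤-trans (ℤ.+-monoˡ-≤ (ℤ.- 1ℤ) (ℤ.+-monoʳ-≤ (+ ∣ σ ∣) content≤C)) long))
    -- The bound from `C σ` holds even before `2 * ones σ` is added on the right.
    (m≤m+n _ _)
  where
  k<len = part>0⇒<length σ k (<⇒≤ 2≤)
  i     = fromℕ< k<len
  i≡k   = toℕ-fromℕ< k<len

  lookup≡ : lookup σ i ≡ part σ k
  lookup≡ = trans (lookup≡part σ i) (cong (part σ) i≡k)

  content≤C : part σ k ⊖ suc k ℤ.≤ C σ
  content≤C = subst₂ (λ p j → p ⊖ suc j ℤ.≤ C σ) lookup≡ i≡k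
    (C-upper σ i (subst₂ (λ j p → part σ (suc j) < p) (sym i≡k) (sym lookup≡) c))

-- With all parts at least 2, the corner attaining `C ρ` is tall and `ones ρ` vanishes, so its
-- instance of `Bounded` is the claim.
bounded⇒C-bound : ∀ m {ρ} → IsPartition ρ → ρ ≢ [] → All (2 ≤_) ρ →
  Bounded (m ∷ ρ) → + m ℤ.≥ + ∣ ρ ∣ ℤ.+ C ρ ℤ.- 1ℤ
bounded⇒C-bound m {ρ} ρ-part ρ≢[] 2≤ρ b
  with i , r , C≡ ← C-attained ρ-part ρ≢[]
  rewrite C≡ | lookup≡part ρ i =
  from (content-bound m ∣ ρ ∣ (part ρ (toℕ i)) (toℕ i))
    (subst (∣ ρ ∣ + part ρ (toℕ i) ≤_)
      (trans (cong (λ o → m + 2 + toℕ i + 2 * o) ones≡0) (+-identityʳ _))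
      (b (toℕ i) (r , 2≤part)))
  where
  ones≡0 : ones ρ ≡ 0
  ones≡0 = cong length (filter-none (_≟ 1) (All.map >⇒≢ 2≤ρ))

  2≤part : 2 ≤ part ρ (toℕ i)
  2≤part = subst (2 ≤_) (lookup≡part ρ i) (All.lookup 2≤ρ (∈-lookup i))

shortenFirstRow : ∀ a x ρ t → x ≤ a → 0 < a →
  Star NodeMove (a + t ∷ x ∷ ρ) ⟨ a , x ∷ ρ ,1^ t ⟩
shortenFirstRow a x ρ zero    x≤a 0<a rewrite +-identityʳ a | ++-identityʳ ρ = ε
shortenFirstRow a x ρ (suc t) x≤a 0<a
  rewrite +-suc a t | sym (++-assoc ρ (1 ∷ []) (replicate t 1)) =
  -- The first row is now `suc (a + t)`, which exceeds both `x` and 1.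
  (zero , s≤s (m≤n⇒m≤n+o t x≤a) , s≤s (m≤n⇒m≤n+o t 0<a) , refl)
  ◅ shortenFirstRow a x (ρ ∷ʳ 1) t x≤a 0<a

proposition9p2 : ∀ (a t : ℕ) (ρ : List ℕ) →
    IsPartition ρ → ρ ≢ [] → All (2 ≤_) ρ → a ≥ part ρ 0 →
    NodeMovingClosure LongFirstRow ⟨ a , ρ ,1^ t ⟩
      ⇔ (+ (a + t) ℤ.≥ + ∣ ρ ∣ ℤ.+ C ρ ℤ.- 1ℤ)
proposition9p2 a t []          _      ρ≢[] _   _   = contradiction refl ρ≢[]
proposition9p2 a t ρ@(x ∷ xs) ρ-part ρ≢[] 2≤ρ@(2≤x ∷ _) x≤a = mk⇔
  (λ (μ , long , moves) → bounded⇒C-bound (a + t) ρ-part ρ≢[] 2≤ρ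
    (bounded-++-1^ a ρ t (bounded-nodeMoves moves (longFirstRow⇒bounded long))))
  (λ long → a + t ∷ ρ
    , (a + t , ρ , refl , ρ-part , ρ≢[] , m≤n⇒m≤n+o t x≤a , long)
    , shortenFirstRow a x xs t x≤a (≤-trans (<⇒≤ 2≤x) x≤a))
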